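{- A poset is geometric if and only if it is isomorphic to the poset of flats $F(\mathscr{M})$ of some matroid scheme $\mathscr{M}$. Furthermore, each geometric poset is the poset of flats of a unique simple matroid scheme, up to isomorphism of matroid schemes.
   Context: A finite poset $S$ is a simplicial poset if it has a unique minimum $\hat 0$, is ranked (there is an order-preserving rank function with $\mathrm{rank}(\hat0)=0$ increasing by one along cover relations), and for every $x\in S$ the lower interval $S_{\le x}=\{y\in S: y\le x\}$ is isomorphic to the Boolean lattice of all subsets of the set of atoms (rank-one elements) lying below $x$. Write $|x|$ for the rank of $x$ and $\mathrm{at}(S)$ for the set of atoms. For $T\subseteq S$, $\bigvee T$ denotes the set of minimal common upper bounds of $T$ and $\bigwedge T$ the set of maximal common lower bounds; $x\vee y:=\bigvee\{x,y\}$, $x\wedge y:=\bigwedge\{x,y\}$ (if $x\vee y\ne\emptyset$ then $x\wedge y$ has exactly one element, also denoted $x\wedge y$). A matroid scheme is a pair $(S,\rho)$ with $S$ a finite simplicial poset and $\rho:S\to\mathbb{Z}_{\ge0}$ such that: (M1) $0\le\rho(x)\le|x|$; (M2) $x\le y$ implies $\rho(x)\le\rho(y)$; (M3) if $u\in x\vee y$ then $\rho(x)+\rho(y)\ge\rho(u)+\rho(x\wedge y)$; (M4) if $\ell\in x\wedge y$ and $\rho(x)=\rho(\ell)$ then $x\vee y\ne\emptyset$; (M5) if $\rho(x)<\rho(y)$ then there is $a\in\mathrm{at}(S)$ with $a\le y$, $a\not\le x$ and $x\vee a\ne\emptyset$. Two matroid schemes $(S,\rho),(S',\rho')$ are isomorphic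 if there is a poset isomorphism $\phi:S\to S'$ with $\rho'(\phi(x))=\rho(x)$. For $x\in S$, the closure $\mathrm{cl}(x)$ is the unique maximal element of $\{y\in S: y\ge x,\ \rho(y)=\rho(x)\}$; $x$ is a flat if $\mathrm{cl}(x)=x$, and the poset of flats $F(\mathscr{M})$ is the subposet of flats (ranked by $\rho$). An atom $a$ is a loop if $\rho(a)=0$. A matroid scheme is simple if every atom is a flat and not a loop. A geometric poset is a poset $P$ with a unique minimum $\hat0$, ranked by a function $\rho$, such that (G1) for every maximal element $m$ of $P$ the interval $P_{\le m}$ is a geometric lattice, and (G2) for every $x\in P$, every set $A$ of atoms of $P$, and every $y\in\bigvee A$ with $\rho(x)<\rho(y)=|A|$, there exists $a\in A$ with $a\not\le x$ and $a\vee x\ne\emptyset$.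
   Formalization: All posets are assumed finite; for infinite ones the claim fails: a minimum with infinitely many incomparable atoms above it is a geometric poset, but it is not the poset of flats of any (finite) matroid scheme. -}

module Defs where

open import Data.Nat using (ℕ; zero; suc; _+_; _<_) renaming (_≤_ to _≤ℕ_)
open import Data.Fin using (Fin)
open import Data.Fin.Subset using (Subset; _∈_; _⊆_; ∣_∣)
open import Data.Bool using (Bool; T)
open import Data.Product using (Σ; ∃; ∃-syntax; _×_; _,_)
open import Data.Sum using (_⊎_)
open import Data.Unit using (⊤)
open import Relation.Nullary using (¬_)
open import Relation.Binary.PropositionalEquality using (_≡_; _≢_)
open import Function.Bundles using (_⇔_)

record FinPoset : Set where
  field
    n  : ℕ
    le : Fin n → Fin n → Bool

  _≤_ : Fin n → Fin n → Set
  x ≤ y = T (le x y)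

  field
    ≤-refl    : ∀ x → x ≤ x
    ≤-antisym : ∀ x y → x ≤ y → y ≤ x → x ≡ y
    ≤-trans   : ∀ x y z → x ≤ y → y ≤ z → x ≤ z

module _ (P : FinPoset) where
  open FinPoset P

  Covers : Fin n → Fin n → Set
  Covers x y = x ≤ y × x ≢ y × (∀ z → x ≤ z → z ≤ y → z ≡ x ⊎ z ≡ y)

  IsMinimum : Fin n → Set
  IsMinimum b = ∀ x → b ≤ x

  IsMaximal : Fin n → Set
  IsMaximal m = ∀ y → m ≤ y → y ≡ m

  IsRankFunction : Fin n → (Fin n → ℕ) → Set
  IsRankFunction b r =
    (r b ≡ 0) × (∀ x y → x ≤ y → r x ≤ℕ r y)
              × (∀ x y → Covers x y → r y ≡ suc (r x))

  InJoin : Fin n → Fin n → Fin n → Set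
  InJoin x y z = (x ≤ z × y ≤ z) ×
    (∀ w → x ≤ w → y ≤ w → w ≤ z → w ≡ z)

  InMeet : Fin n → Fin n → Fin n → Set
  InMeet x y l = (l ≤ x × l ≤ y) ×
    (∀ w → w ≤ x → w ≤ y → l ≤ w → w ≡ l)

  JoinNonempty : Fin n → Fin n → Set
  JoinNonempty x y = ∃[ z ] InJoin x y z

  InJoinSet : Subset n → Fin n → Set
  InJoinSet A z = (∀ a → a ∈ A → a ≤ z) ×
    (∀ w → (∀ a → a ∈ A → a ≤ w) → w ≤ z → w ≡ z)

  IsLUBBelow : Fin n → Fin n → Fin n → Fin n → Set
  IsLUBBelow m x y z = z ≤ m × x ≤ z × y ≤ z ×
    (∀ w → w ≤ m → x ≤ w → y ≤ w → z ≤ w)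

  IsGLBBelow : Fin n → Fin n → Fin n → Fin n → Set
  IsGLBBelow m x y z = z ≤ m × z ≤ x × z ≤ y ×
    (∀ w → w ≤ m → w ≤ x → w ≤ y → w ≤ z)

  IsGeometricLatticeBelow : (Fin n → ℕ) → Fin n → Set
  IsGeometricLatticeBelow r m =
    (∀ x y → x ≤ m → y ≤ m →
       (∃[ z ] IsLUBBelow m x y z) × (∃[ z ] IsGLBBelow m x y z))
    × (∀ x y j k → x ≤ m → y ≤ m → IsLUBBelow m x y j → IsGLBBelow m x y k →
         r j + r k ≤ℕ r x + r y)
    -- atomistic: each element is the join of the atoms below it
    × (∀ x z → x ≤ m → z ≤ m →
         (∀ a → r a ≡ 1 → a ≤ x → a ≤ z) → x ≤ z)

  IsGeometricPoset : Set
  IsGeometricPoset =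
    Σ (Fin n) λ b → Σ (Fin n → ℕ) λ r →
      IsMinimum b × IsRankFunction b r
      × (∀ m → IsMaximal m → IsGeometricLatticeBelow r m)
      × (∀ x (A : Subset n) y → (∀ a → a ∈ A → r a ≡ 1) →
           InJoinSet A y → r x < r y → r y ≡ ∣ A ∣ →
           ∃[ a ] (a ∈ A × ¬ (a ≤ x) × JoinNonempty a x))

record IsoOnto (A : Set) (_≤A_ : A → A → Set)
               (P : FinPoset) (Q : Fin (FinPoset.n P) → Set) : Set where
  open FinPoset P
  field
    f          : A → Fin n
    f-into     : ∀ a → Q (f a)
    f-onto     : ∀ x → Q x → ∃[ a ] f a ≡ x
    f-injective : ∀ a b → f a ≡ f b → a ≡ b
    f-order    : ∀ a b → (a ≤A b) ⇔ (f a ≤ f b)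

_≅_ : FinPoset → FinPoset → Set
P ≅ P' = IsoOnto (Fin (FinPoset.n P)) (FinPoset._≤_ P) P' (λ _ → ⊤)

record SimplicialPoset : Set where
  field
    poset : FinPoset
  open FinPoset poset public
  field
    bot       : Fin n
    bot-min   : IsMinimum poset bot
    rk        : Fin n → ℕ
    rk-ranked : IsRankFunction poset bot rk
    -- every lower interval S_{≤x} is isomorphic to the Boolean lattice
    -- of all subsets of a k-element set (necessarily k = #atoms below x)
    boolean   : ∀ x → Σ ℕ λ k →
                  IsoOnto (Subset k) _⊆_ poset (λ y → y ≤ x)

  IsAtom : Fin n → Set
  IsAtom a = rk a ≡ 1

record MatroidScheme : Set where
  field
    S : SimplicialPoset
  open SimplicialPoset S public
  field
    ρ  : Fin n → ℕ
    M1 : ∀ x → ρ x ≤ℕ rk x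
    M2 : ∀ x y → x ≤ y → ρ x ≤ℕ ρ y
    M3 : ∀ x y u l → InJoin poset x y u → InMeet poset x y l →
           ρ u + ρ l ≤ℕ ρ x + ρ y
    M4 : ∀ x y l → InMeet poset x y l → ρ x ≡ ρ l → JoinNonempty poset x y
    M5 : ∀ x y → ρ x < ρ y →
           ∃[ a ] (IsAtom a × a ≤ y × ¬ (a ≤ x) × JoinNonempty poset x a)

  -- x is a flat: cl(x) = x, i.e. x is the greatest element of
  -- {y ≥ x : ρ y = ρ x}
  IsFlat : Fin n → Set
  IsFlat x = ∀ y → x ≤ y → ρ y ≡ ρ x → y ≤ x

  IsLoop : Fin n → Set
  IsLoop a = IsAtom a × ρ a ≡ 0

  IsSimple : Set
  IsSimple = ∀ a → IsAtom a → IsFlat a × ¬ (ρ a ≡ 0)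

_≅Flats_ : FinPoset → MatroidScheme → Set
P ≅Flats M = IsoOnto (Fin (FinPoset.n P)) (FinPoset._≤_ P)
                     (MatroidScheme.poset M) (MatroidScheme.IsFlat M)

_≅MS_ : MatroidScheme → MatroidScheme → Set
M ≅MS M' = Σ (MatroidScheme.poset M ≅ MatroidScheme.poset M') λ φ →
  ∀ x → MatroidScheme.ρ M' (IsoOnto.f φ x) ≡ MatroidScheme.ρ M x

{-# OPTIONS --safe #-}
module Submission where

-- For a matroid scheme, (M4) and (M3) show that a flat z ≥ x lies above every y ≥ x with
-- ρ y = ρ x, so closure is left adjoint to the inclusion of the flats and transports the
-- lattice structure and submodularity of the Boolean intervals to the flats. For (G2), apply
-- (M5) to the element spanned by all atoms lying below members of A, whose closure is y.
--
-- Conversely, a geometric poset P gives the scheme of pairs (A , x) with A a set of atoms and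
-- x ∈ ⋁ A, ordered componentwise, with ρ (A , x) the rank of x. Its flats are the pairs
-- (atoms below x , x), and (G2) applied to a basis of A yields (M5). A simple scheme is
-- isomorphic to this one through s ↦ (atoms below s , closure of s), whence uniqueness.

open import Defs
open import Data.Bool using (Bool; T)
open import Data.Bool.Properties using (T?)
open import Data.Fin using (Fin; zero; suc; combine; remQuot; _≟_)
open import Data.Fin.Induction using (po-wellFounded)
open import Data.Fin.Properties using (any?; all?; remQuot-combine; suc-injective)
open import Data.Fin.Subset using (Subset; inside; outside; _∈_; _∉_; _⊆_; ∣_∣; ⊥; ⁅_⁆; _∪_; _∩_; _-_)
open import Data.Fin.Subset.Properties
open import Data.Nat using (ℕ; zero; suc; _+_; _*_; _^_; _<_; z≤n; s≤s)
  renaming (_≤_ to _≤ℕ_; _≟_ to _≟ℕ_)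
import Data.Nat.Properties as ℕ
open import Data.Nat.Induction using (<-wellFounded)
open import Data.Product using (Σ; ∃; ∃-syntax; _×_; _,_; proj₁; proj₂)
open import Data.Sum using (_⊎_; inj₁; inj₂)
open import Data.Unit using (tt)
open import Data.Vec using ([]; _∷_; here; there; tabulate)
open import Data.Vec.Properties using (lookup∘tabulate; []=⇒lookup; lookup⇒[]=)
open import Function using (_∘_)
open import Function.Bundles using (_⇔_; mk⇔; Equivalence)
open import Induction.WellFounded using (Acc; acc; WellFounded)
open import Relation.Binary.PropositionalEquality
  using (_≡_; _≢_; refl; sym; trans; cong; cong₂; subst; subst₂; isEquivalence)
open import Relation.Binary.Structures using (IsPartialOrder)
open import Relation.Nullary using (¬_; Dec; yes; no; does; contradiction)
open import Relation.Nullary.Decidable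
  using (_×-dec_; _→-dec_; ¬?; decidable-stable; toWitness; fromWitness; dec-true; isYes)

-- Subsets of a finite set.

module _ {n : ℕ} {Q : Fin n → Set} (Q? : ∀ x → Dec (Q x)) where

  sift : Subset n
  sift = tabulate (does ∘ Q?)

  ∈-sift⁺ : ∀ {x} → Q x → x ∈ sift
  ∈-sift⁺ {x} q = lookup⇒[]= x sift (trans (lookup∘tabulate (does ∘ Q?) x) (dec-true (Q? x) q))

  ∈-sift⁻ : ∀ {x} → x ∈ sift → Q x
  ∈-sift⁻ {x} x∈ with Q? x | trans (sym (lookup∘tabulate (does ∘ Q?) x)) ([]=⇒lookup x∈)
  ... | yes q | _ = q
  ... | no _  | ()

-- The increasing bijection from `Fin ∣ A ∣` onto `A`. It turns a subset into a finite type, both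
-- for enumerations and for the coordinates of Boolean intervals.
index : ∀ {n} (A : Subset n) → Fin ∣ A ∣ → Fin n
index (inside  ∷ A) zero    = zero
index (inside  ∷ A) (suc i) = suc (index A i)
index (outside ∷ A) i       = suc (index A i)

index-∈ : ∀ {n} (A : Subset n) i → index A i ∈ A
index-∈ (inside  ∷ A) zero    = here
index-∈ (inside  ∷ A) (suc i) = there (index-∈ A i)
index-∈ (outside ∷ A) i       = there (index-∈ A i)

index-injective : ∀ {n} (A : Subset n) {i j} → index A i ≡ index A j → i ≡ j
index-injective (inside  ∷ A) {zero}  {zero}  _  = refl
index-injective (inside  ∷ A) {suc i} {suc j} eq = cong suc (index-injective A (suc-injective eq))
index-injective (outside ∷ A) eq = index-injective A (suc-injective eq)

index-onto : ∀ {n} (A : Subset n) {x} → x ∈ A → ∃[ i ] index A i ≡ x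
index-onto (inside  ∷ A) here       = zero , refl
index-onto (inside  ∷ A) (there x∈) with i , refl ← index-onto A x∈ = suc i , refl
index-onto (outside ∷ A) (there x∈) with i , refl ← index-onto A x∈ = i , refl

∣p∪⁅x⁆∣≡1+∣p∣ : ∀ {n} (p : Subset n) {x} → x ∉ p → ∣ p ∪ ⁅ x ⁆ ∣ ≡ suc ∣ p ∣
∣p∪⁅x⁆∣≡1+∣p∣ (inside  ∷ p) {zero}  x∉ = contradiction here x∉
∣p∪⁅x⁆∣≡1+∣p∣ (outside ∷ p) {zero}  x∉ = cong (suc ∘ ∣_∣) (∪-identityʳ p)
∣p∪⁅x⁆∣≡1+∣p∣ (inside  ∷ p) {suc x} x∉ = cong suc (∣p∪⁅x⁆∣≡1+∣p∣ p (x∉ ∘ there))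
∣p∪⁅x⁆∣≡1+∣p∣ (outside ∷ p) {suc x} x∉ = ∣p∪⁅x⁆∣≡1+∣p∣ p (x∉ ∘ there)

⁅x⁆⊆p : ∀ {n} {x : Fin n} {p} → x ∈ p → ⁅ x ⁆ ⊆ p
⁅x⁆⊆p {x = x} {p} x∈p y∈ = subst (_∈ p) (sym (x∈⁅y⁆⇒x≡y x y∈)) x∈p

∪-least : ∀ {n} (p q : Subset n) {r} → p ⊆ r → q ⊆ r → p ∪ q ⊆ r
∪-least p q p⊆r q⊆r x∈ with x∈p∪q⁻ p q x∈
... | inj₁ x∈p = p⊆r x∈p
... | inj₂ x∈q = q⊆r x∈q

-- Enumeration of decidable predicates through finite codes.

encode : ∀ {n} → Subset n → Fin (2 ^ n)
encode []            = zero
encode (outside ∷ A) = combine {2} zero (encode A)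
encode (inside  ∷ A) = combine {2} (suc zero) (encode A)

decode : ∀ n → Fin (2 ^ n) → Subset n
decode zero    _ = []
decode (suc n) i with remQuot {2} (2 ^ n) i
... | zero  , j = outside ∷ decode n j
... | suc _ , j = inside ∷ decode n j

decode-encode : ∀ {n} (A : Subset n) → decode n (encode A) ≡ A
decode-encode [] = refl
decode-encode {suc n} (outside ∷ A)
  rewrite remQuot-combine {2} zero (encode A) = cong (outside ∷_) (decode-encode A)
decode-encode {suc n} (inside ∷ A)
  rewrite remQuot-combine {2} (suc zero) (encode A) = cong (inside ∷_) (decode-encode A)

-- The carrier of a `FinPoset` has the form `Fin n`, so the elements satisfying `Q` must be
-- presented in that form.
record Enumeration {E : Set} (Q : E → Set) : Set where
  field
    size         : ℕ
    el           : Fin size → E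
    el-valid     : ∀ i → Q (el i)
    el-injective : ∀ {i j} → el i ≡ el j → i ≡ j
    el-onto      : ∀ e → Q e → ∃[ i ] el i ≡ e

enumerate : ∀ {E : Set} {k} (enc : E → Fin k) (dec : Fin k → E) → (∀ e → dec (enc e) ≡ e) →
  {Q : E → Set} → (∀ e → Dec (Q e)) → Enumeration Q
enumerate {k = k} enc dec dec-enc {Q} Q? = record
  { size = ∣ support ∣
  ; el = λ i → dec (index support i)
  ; el-valid = λ i → proj₁ (∈-sift⁻ Code? (index-∈ support i))
  ; el-injective = λ {i} {j} eq → index-injective support
      (trans (sym (canonical i)) (trans (cong enc eq) (canonical j)))
  ; el-onto = onto }
  where
  -- Only canonical codes are kept, so that dec is injective on the support.
  Code? : ∀ i → Dec (Q (dec i) × enc (dec i) ≡ i)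
  Code? i = Q? (dec i) ×-dec (enc (dec i) ≟ i)

  support : Subset k
  support = sift Code?

  canonical : ∀ i → enc (dec (index support i)) ≡ index support i
  canonical i = proj₂ (∈-sift⁻ Code? (index-∈ support i))

  onto : ∀ e → Q e → ∃[ i ] dec (index support i) ≡ e
  onto e q with i , eq ← index-onto support (∈-sift⁺ Code? {enc e}
                     (subst Q (sym (dec-enc e)) q , cong enc (dec-enc e)))
    = i , trans (cong dec eq) (dec-enc e)

-- Minimal elements, bounds and joins in a finite poset.

dual : FinPoset → FinPoset
dual P = record
  { n = n ; le = λ x y → le y x ; ≤-refl = ≤-refl
  ; ≤-antisym = λ x y p q → ≤-antisym x y q p
  ; ≤-trans = λ x y z p q → ≤-trans z y x q p }
  where open FinPoset P

module Order (P : FinPoset) where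
  open FinPoset P

  infixr 5 _⨾_
  _⨾_ : ∀ {x y z} → x ≤ y → y ≤ z → x ≤ z
  _⨾_ = ≤-trans _ _ _

  reflexive : ∀ {x y} → x ≡ y → x ≤ y
  reflexive refl = ≤-refl _

  antisym : ∀ {x y} → x ≤ y → y ≤ x → x ≡ y
  antisym = ≤-antisym _ _

  infix 4 _≤?_
  _≤?_ : ∀ x y → Dec (x ≤ y)
  x ≤? y = T? (le x y)

  isPartialOrder : IsPartialOrder _≡_ _≤_
  isPartialOrder = record
    { isPreorder = record { isEquivalence = isEquivalence ; reflexive = reflexive ; trans = _⨾_ }
    ; antisym = antisym }

  ≤-wellFounded : WellFounded (λ x y → x ≤ y × x ≢ y)
  ≤-wellFounded = po-wellFounded isPartialOrder

  minimal-below : {Q : Fin n → Set} → (∀ x → Dec (Q x)) → ∀ x → Q x →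
    ∃[ z ] (z ≤ x × Q z × (∀ w → Q w → w ≤ z → w ≡ z))
  minimal-below {Q} Q? x = go x (≤-wellFounded x)
    where
    go : ∀ x → Acc (λ x y → x ≤ y × x ≢ y) x → Q x →
      ∃[ z ] (z ≤ x × Q z × (∀ w → Q w → w ≤ z → w ≡ z))
    go x (acc rs) q with any? (λ w → Q? w ×-dec (w ≤? x ×-dec ¬? (w ≟ x)))
    ... | yes (w , qw , w≤x , w≢x) with z , z≤w , rest ← go w (rs (w≤x , w≢x)) qw
          = z , z≤w ⨾ w≤x , rest
    ... | no ¬smaller = x , ≤-refl x , q , λ w qw w≤x →
            decidable-stable (w ≟ x) λ w≢x → ¬smaller (w , qw , w≤x , w≢x)

module _ (P : FinPoset) where
  open FinPoset P
  open Order P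

  maximal-above : {Q : Fin n → Set} → (∀ x → Dec (Q x)) → ∀ x → Q x →
    ∃[ z ] (x ≤ z × Q z × (∀ w → Q w → z ≤ w → w ≡ z))
  maximal-above = Order.minimal-below (dual P)

  maximum-above : ∀ x → ∃[ m ] (x ≤ m × IsMaximal P m)
  maximum-above x with m , x≤m , _ , max ← maximal-above (λ _ → yes tt) x tt
    = m , x≤m , λ y → max y tt

  -- A minimal element among the upper bounds below `u` is minimal among all of them. The joins
  -- demanded by (M4), (M5) and (G2) are all obtained by exhibiting a bound.
  bounded⇒join : ∀ {x y u} → x ≤ u → y ≤ u → JoinNonempty P x y
  bounded⇒join {x} {y} {u} x≤u y≤u
    with z , _ , ub , min ← minimal-below (λ w → x ≤? w ×-dec y ≤? w) u (x≤u , y≤u)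
    = z , ub , λ w x≤w y≤w → min w (x≤w , y≤w)

  meet-above : ∀ {x y l} → l ≤ x → l ≤ y → ∃[ k ] (l ≤ k × InMeet P x y k)
  meet-above {x} {y} {l} l≤x l≤y
    with k , l≤k , lb , max ← maximal-above (λ w → w ≤? x ×-dec w ≤? y) l (l≤x , l≤y)
    = k , l≤k , lb , λ w w≤x w≤y → max w (w≤x , w≤y)

  UpperBound : Subset n → Fin n → Set
  UpperBound A z = ∀ a → a ∈ A → a ≤ z

  upperBound? : ∀ A z → Dec (UpperBound A z)
  upperBound? A z = all? λ a → (a ∈? A) →-dec (a ≤? z)

  inJoinSet? : ∀ A z → Dec (InJoinSet P A z)
  inJoinSet? A z = upperBound? A z ×-dec
    all? λ w → upperBound? A w →-dec (w ≤? z →-dec (w ≟ z))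

  joinSet-below : ∀ {A u} → UpperBound A u → ∃[ z ] (z ≤ u × InJoinSet P A z)
  joinSet-below {A} {u} ub with z , z≤u , ub′ , min ← minimal-below (upperBound? A) u ub
    = z , z≤u , ub′ , min

  lub⇒join : ∀ {m x y z} → IsLUBBelow P m x y z → InJoin P x y z
  lub⇒join (z≤m , x≤z , y≤z , least) =
    (x≤z , y≤z) , λ w x≤w y≤w w≤z → antisym w≤z (least w (w≤z ⨾ z≤m) x≤w y≤w)

  glb⇒meet : ∀ {m x y z} → x ≤ m → IsGLBBelow P m x y z → InMeet P x y z
  glb⇒meet x≤m (z≤m , z≤x , z≤y , greatest) =
    (z≤x , z≤y) , λ w w≤x w≤y z≤w → antisym (greatest w (w≤x ⨾ x≤m) w≤x w≤y) z≤w

-- Rank functions.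

module Ranked (P : FinPoset) {b} {r} (b-min : IsMinimum P b) (ranked : IsRankFunction P b r) where
  open FinPoset P
  open Order P

  rank-bot : r b ≡ 0
  rank-bot = proj₁ ranked

  rank-mono : ∀ {x y} → x ≤ y → r x ≤ℕ r y
  rank-mono = proj₁ (proj₂ ranked) _ _

  rank-cover : ∀ {x y} → Covers P x y → r y ≡ suc (r x)
  rank-cover = proj₂ (proj₂ ranked) _ _

  -- Otherwise a minimal element strictly above `x` and still below `y` covers `x`, and its rank
  -- `suc (r x)` is at most `r y`.
  rank-strict : ∀ {x y} → x ≤ y → r x ≡ r y → x ≡ y
  rank-strict {x} {y} x≤y eq = decidable-stable (x ≟ y) λ x≢y →
    let z , z≤y , (x≤z , z≢x) , min =
          minimal-below (λ z → x ≤? z ×-dec ¬? (z ≟ x)) y (x≤y , x≢y ∘ sym)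
        cover : Covers P x z
        cover = x≤z , z≢x ∘ sym , λ w x≤w w≤z → case-≡ w x≤w w≤z min
    in ℕ.<-irrefl eq (subst (_≤ℕ r y) (rank-cover cover) (rank-mono z≤y))
    where
    case-≡ : ∀ {z} w → x ≤ w → w ≤ z →
      (∀ w → x ≤ w × w ≢ x → w ≤ z → w ≡ z) → w ≡ x ⊎ w ≡ z
    case-≡ w x≤w w≤z min with w ≟ x
    ... | yes w≡x = inj₁ w≡x
    ... | no  w≢x = inj₂ (min w (x≤w , w≢x) w≤z)

  rank-mono-< : ∀ {x y} → x ≤ y → x ≢ y → r x < r y
  rank-mono-< x≤y x≢y = ℕ.≤∧≢⇒< (rank-mono x≤y) (x≢y ∘ rank-strict x≤y)

  cover-below : ∀ {x} → x ≢ b → ∃[ w ] Covers P w x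
  cover-below {x} x≢b
    with w , _ , (w≤x , w≢x) , max ←
      maximal-above P (λ w → w ≤? x ×-dec ¬? (w ≟ x)) b (b-min x , x≢b ∘ sym)
    = w , w≤x , w≢x , between
    where
    between : ∀ z → w ≤ z → z ≤ x → z ≡ w ⊎ z ≡ x
    between z w≤z z≤x with z ≟ x
    ... | yes z≡x = inj₂ z≡x
    ... | no  z≢x = inj₁ (max z (z≤x , z≢x) w≤z)

-- Both functions start at zero and rise by one along the same covers, so induction along an element
-- covered by `x` applies.
rank-unique : ∀ (P : FinPoset) {b b′ r r′} → IsMinimum P b → IsMinimum P b′ →
  IsRankFunction P b r → IsRankFunction P b′ r′ → ∀ x → r x ≡ r′ x
rank-unique P {b} {b′} {r} {r′} b-min b′-min ranked ranked′ x = go x (≤-wellFounded x)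
  where
  open Order P
  module R = Ranked P b-min ranked
  module R′ = Ranked P b′-min ranked′
  go : ∀ x → Acc _ x → r x ≡ r′ x
  go x (acc rs) with x ≟ b
  ... | yes refl = trans R.rank-bot (sym (trans (cong r′ (antisym (b-min b′) (b′-min b))) R′.rank-bot))
  ... | no x≢b with w , cov@(w≤x , w≢x , _) ← R.cover-below x≢b
    = trans (R.rank-cover cov) (trans (cong suc (go w (rs (w≤x , w≢x)))) (sym (R′.rank-cover cov)))

-- Boolean intervals of a simplicial poset.

module Simplicial (S : SimplicialPoset) where
  open SimplicialPoset S
  open Order poset
  open Ranked poset bot-min rk-ranked

  module Interval (m : Fin n) where
    open IsoOnto (proj₂ (boolean m))

    mono : ∀ {I J} → I ⊆ J → f I ≤ f J
    mono {I} {J} I⊆J = Equivalence.to (f-order I J) I⊆J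

    reflect : ∀ {I J} → f I ≤ f J → I ⊆ J
    reflect {I} {J} = Equivalence.from (f-order I J)

    f⊥≡bot : f ⊥ ≡ bot
    f⊥≡bot with J , eq ← f-onto bot (bot-min m) =
      antisym (subst (f ⊥ ≤_) eq (mono (⊥⊆ {p = J}))) (bot-min (f ⊥))

    f⁅i⁆-atom : ∀ i → IsAtom (f ⁅ i ⁆)
    f⁅i⁆-atom i = trans (rank-cover cover) (cong suc rank-bot)
      where
      cover : Covers poset bot (f ⁅ i ⁆)
      cover = bot-min _ , distinct , between
        where
        distinct : bot ≢ f ⁅ i ⁆
        distinct eq = ∉⊥ (subst (i ∈_) (sym (f-injective _ _ (trans f⊥≡bot eq))) (x∈⁅x⁆ i))
        between : ∀ z → bot ≤ z → z ≤ f ⁅ i ⁆ → z ≡ bot ⊎ z ≡ f ⁅ i ⁆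
        between z _ z≤ with f-onto z (z≤ ⨾ f-into ⁅ i ⁆)
        ... | J , refl with i ∈? J
        ...   | yes i∈J = inj₂ (antisym z≤ (mono (⁅x⁆⊆p i∈J)))
        ...   | no  i∉J = inj₁ (trans (cong f (Empty-unique empty)) f⊥≡bot)
          where
          empty : ¬ ∃ (_∈ J)
          empty (j , j∈J) = i∉J (subst (_∈ J) (x∈⁅y⁆⇒x≡y i (reflect z≤ j∈J)) j∈J)

    -- The set mapped to an atom is nonempty because `bot` has rank zero, and any singleton inside
    -- it already has rank one.
    atom≡f⁅i⁆ : ∀ {a} → a ≤ m → IsAtom a → ∃[ i ] f ⁅ i ⁆ ≡ a
    atom≡f⁅i⁆ a≤m rk≡1 with f-onto _ a≤m
    ... | J , refl with nonempty? J
    ...   | yes (i , i∈J) = i , rank-strict (mono (⁅x⁆⊆p i∈J)) (trans (f⁅i⁆-atom i) (sym rk≡1))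
    ...   | no  empty with () ← trans (sym rk≡1)
              (trans (cong rk (trans (cong f (Empty-unique empty)) f⊥≡bot)) rank-bot)

    lub : ∀ {x y} → x ≤ m → y ≤ m → ∃[ z ] IsLUBBelow poset m x y z
    lub x≤m y≤m with f-onto _ x≤m | f-onto _ y≤m
    ... | I , refl | J , refl =
      f (I ∪ J) , f-into _ , mono (p⊆p∪q J) , mono (q⊆p∪q I J) , least
      where
      least : ∀ w → w ≤ m → f I ≤ w → f J ≤ w → f (I ∪ J) ≤ w
      least w w≤m p q with K , refl ← f-onto w w≤m = mono (∪-least I J (reflect p) (reflect q))

    glb : ∀ {x y} → x ≤ m → y ≤ m → ∃[ z ] IsGLBBelow poset m x y z
    glb x≤m y≤m with f-onto _ x≤m | f-onto _ y≤m
    ... | I , refl | J , refl =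
      f (I ∩ J) , f-into _ , mono (p∩q⊆p I J) , mono (p∩q⊆q I J) , greatest
      where
      greatest : ∀ w → w ≤ m → w ≤ f I → w ≤ f J → w ≤ f (I ∩ J)
      greatest w w≤m p q with K , refl ← f-onto w w≤m =
        mono λ x∈ → x∈p∩q⁺ (reflect p x∈ , reflect q x∈)

    -- It suffices to test the hypothesis on the images of singletons.
    atoms-determine : ∀ {x y} → x ≤ m → y ≤ m → (∀ a → IsAtom a → a ≤ x → a ≤ y) → x ≤ y
    atoms-determine x≤m y≤m h with f-onto _ x≤m | f-onto _ y≤m
    ... | I , refl | J , refl = mono λ {i} i∈I →
      reflect (h (f ⁅ i ⁆) (f⁅i⁆-atom i) (mono (⁅x⁆⊆p i∈I))) (x∈⁅x⁆ i)

    -- The realisation half of Booleanness: any decidable set of atoms below `m` spans an element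
    -- with no further atoms. It builds the element fed to (M5) in `exchange` and the preimages in
    -- `φ-onto`.
    select : {Q : Fin n → Set} → (∀ a → Dec (Q a)) → ∃[ x ] (x ≤ m ×
      (∀ a → IsAtom a → a ≤ x → Q a) × (∀ a → IsAtom a → a ≤ m → Q a → a ≤ x))
    select {Q} Q? = f I , f-into I , sound , complete
      where
      I : Subset (proj₁ (boolean m))
      I = sift (λ i → Q? (f ⁅ i ⁆))
      sound : ∀ a → IsAtom a → a ≤ f I → Q a
      sound a at a≤ with i , refl ← atom≡f⁅i⁆ (a≤ ⨾ f-into I) at =
        ∈-sift⁻ (λ i → Q? (f ⁅ i ⁆)) (reflect a≤ (x∈⁅x⁆ i))
      complete : ∀ a → IsAtom a → a ≤ m → Q a → a ≤ f I
      complete a at a≤m q with i , refl ← atom≡f⁅i⁆ a≤m at =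
        mono (⁅x⁆⊆p (∈-sift⁺ (λ i → Q? (f ⁅ i ⁆)) q))

-- Closure and flats in a matroid scheme.

module Flats (M : MatroidScheme) where
  open MatroidScheme M
  open Order poset public
  open Ranked poset bot-min rk-ranked public
  open Simplicial S public

  ρ-bot : ρ bot ≡ 0
  ρ-bot = ℕ.n≤0⇒n≡0 (subst (ρ bot ≤ℕ_) rank-bot (M1 bot))

  -- A meet `l` of `y` and `z` above `x` has the same `ρ` as `y`, so (M4) provides a join `v`. By
  -- (M3) its `ρ` is at most that of `z`, and flatness of `z` forces `v ≤ z`.
  flat-absorbs : ∀ {x y z} → x ≤ y → ρ y ≡ ρ x → x ≤ z → IsFlat z → y ≤ z
  flat-absorbs {x} {y} {z} x≤y ρy≡ρx x≤z flat =
    let l , x≤l , meet@((l≤y , l≤z) , _) = meet-above poset x≤y x≤z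
        ρy≡ρl = ℕ.≤-antisym (ℕ.≤-trans (ℕ.≤-reflexive ρy≡ρx) (M2 x l x≤l)) (M2 l y l≤y)
        v , join@((y≤v , z≤v) , _) = M4 y z l meet ρy≡ρl
        ρv≤ρz = ℕ.+-cancelʳ-≤ (ρ l) (ρ v) (ρ z)
          (subst (ρ v + ρ l ≤ℕ_) (trans (cong (_+ ρ z) ρy≡ρl) (ℕ.+-comm (ρ l) (ρ z)))
            (M3 y z v l join meet))
    in y≤v ⨾ flat v z≤v (ℕ.≤-antisym ρv≤ρz (M2 z v z≤v))

  -- Finiteness yields a maximal element above `x` with the same `ρ`; that it is the greatest such
  -- element follows from `flat-absorbs`.
  closure : ∀ x → ∃[ c ] (x ≤ c × ρ c ≡ ρ x × IsFlat c)
  closure x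
    with c , _ , (x≤c , ρc≡ρx) , max ←
      maximal-above poset (λ y → x ≤? y ×-dec (ρ y ≟ℕ ρ x)) x (≤-refl x , refl)
    = c , x≤c , ρc≡ρx , λ y c≤y ρy≡ρc → reflexive (max y (x≤c ⨾ c≤y , trans ρy≡ρc ρc≡ρx) c≤y)

  ρ-lub : ∀ {m x y u l} → x ≤ m → IsLUBBelow poset m x y u → IsGLBBelow poset m x y l →
    ρ u + ρ l ≤ℕ ρ x + ρ y
  ρ-lub {x = x} {y} {u} {l} x≤m lub glb =
    M3 x y u l (lub⇒join poset lub) (glb⇒meet poset x≤m glb)

  ρ-atom≤1 : ∀ {a} → IsAtom a → ρ a ≤ℕ 1
  ρ-atom≤1 {a} at = subst (ρ a ≤ℕ_) at (M1 a)

  ρ-nonloop : ∀ {a} → IsAtom a → ρ a ≢ 0 → ρ a ≡ 1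
  ρ-nonloop at ≢0 = ℕ.≤-antisym (ρ-atom≤1 at) (ℕ.n≢0⇒n>0 ≢0)

-- The poset of flats is geometric.

module FlatPoset (M : MatroidScheme) (P : FinPoset) (iso : P ≅Flats M) where
  open MatroidScheme M
  open Flats M
  open IsoOnto iso
  module P where
    open FinPoset P public
    open Order P public

  r : Fin P.n → ℕ
  r = ρ ∘ f

  f-mono : ∀ {p q} → p P.≤ q → f p ≤ f q
  f-mono = Equivalence.to (f-order _ _)

  f-reflect : ∀ {p q} → f p ≤ f q → p P.≤ q
  f-reflect = Equivalence.from (f-order _ _)

  cl : Fin n → Fin P.n
  cl x = proj₁ (f-onto _ (proj₂ (proj₂ (proj₂ (closure x)))))

  f-cl : ∀ x → f (cl x) ≡ proj₁ (closure x)
  f-cl x = proj₂ (f-onto _ (proj₂ (proj₂ (proj₂ (closure x)))))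

  ≤-cl : ∀ x → x ≤ f (cl x)
  ≤-cl x = subst (x ≤_) (sym (f-cl x)) (proj₁ (proj₂ (closure x)))

  r-cl : ∀ x → r (cl x) ≡ ρ x
  r-cl x = trans (cong ρ (f-cl x)) (proj₁ (proj₂ (proj₂ (closure x))))

  -- With `≤-cl`, this is the adjunction between `cl` and `f`.
  cl-least : ∀ {x p} → x ≤ f p → cl x P.≤ p
  cl-least {x} {p} x≤fp = f-reflect (flat-absorbs (≤-cl x) (r-cl x) x≤fp (f-into p))

  -- Such an `x` has the same `ρ` as `bot`, so every flat absorbs it.
  loop≤ : ∀ {x} p → ρ x ≡ 0 → x ≤ f p
  loop≤ {x} p ρx≡0 =
    flat-absorbs (bot-min x) (trans ρx≡0 (sym ρ-bot)) (bot-min (f p)) (f-into p)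

  cl-bot-min : IsMinimum P (cl bot)
  cl-bot-min p = cl-least (bot-min (f p))

  new-atom : ∀ {p q} → p P.≤ q → p ≢ q → ∃[ s ] (IsAtom s × s ≤ f q × ¬ (s ≤ f p))
  new-atom {p} {q} p≤q p≢q
    with any? (λ s → (rk s ≟ℕ 1) ×-dec (s ≤? f q ×-dec ¬? (s ≤? f p)))
  ... | yes found = found
  ... | no  none  = contradiction
    (P.antisym p≤q (f-reflect (Interval.atoms-determine (f q) (≤-refl (f q)) (f-mono p≤q)
      λ s at s≤fq → decidable-stable (s ≤? f p) λ s≰fp → none (s , at , s≤fq , s≰fp)))) p≢q

  -- Join to `f p` an atom `s` of `f q` outside it. Submodularity lets `ρ` grow by at most one and
  -- flatness of `f p` makes it grow. The closure of the result lies between `p` and `q` and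
  -- contains `s`, hence is `q`.
  r-cover : ∀ p q → Covers P p q → r q ≡ suc (r p)
  r-cover p q (p≤q , p≢q , between) =
    let s , at , s≤fq , s≰fp = new-atom p≤q p≢q
        fp≤fq = f-mono p≤q
        u , lub@(u≤fq , fp≤u , s≤u , _) = Interval.lub (f q) fp≤fq s≤fq
        l , glb = Interval.glb (f q) fp≤fq s≤fq
        ρu≤ = ℕ.≤-trans (ℕ.m≤m+n (ρ u) (ρ l)) (ℕ.≤-trans (ρ-lub fp≤fq lub glb)
                (ℕ.≤-trans (ℕ.+-monoʳ-≤ (r p) (ρ-atom≤1 at)) (ℕ.≤-reflexive (ℕ.+-comm (r p) 1))))
        ρu≢ = λ ρu≡ → s≰fp (s≤u ⨾ f-into p u fp≤u ρu≡)
        ρu≡ = ℕ.≤-antisym ρu≤ (ℕ.≤∧≢⇒< (M2 (f p) u fp≤u) (ρu≢ ∘ sym))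
    in helper u s s≤u s≰fp ρu≡ (between (cl u) (f-reflect (fp≤u ⨾ ≤-cl u)) (cl-least u≤fq))
    where
    helper : ∀ u s → s ≤ u → ¬ (s ≤ f p) → ρ u ≡ suc (r p) →
      cl u ≡ p ⊎ cl u ≡ q → r q ≡ suc (r p)
    helper u s s≤u s≰fp ρu≡ (inj₁ eq) = contradiction (s≤u ⨾ ≤-cl u ⨾ reflexive (cong f eq)) s≰fp
    helper u s s≤u s≰fp ρu≡ (inj₂ refl) = trans (r-cl u) ρu≡

  r-ranked : IsRankFunction P (cl bot) r
  r-ranked = trans (r-cl bot) ρ-bot , (λ p q p≤q → M2 (f p) (f q) (f-mono p≤q)) , r-cover

  -- Joins and meets of flats are closures of the Boolean ones below `f m`, by the adjunction.
  lattice : ∀ m → IsGeometricLatticeBelow P r m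
  lattice m = (λ p q p≤m q≤m → lub p q (f-mono p≤m) (f-mono q≤m) ,
                               glb p q (f-mono p≤m) (f-mono q≤m))
            , semimodular , atomistic
    where
    open Interval (f m) using (atoms-determine) renaming (lub to lubS; glb to glbS)

    lub : ∀ p q → f p ≤ f m → f q ≤ f m → ∃[ z ] IsLUBBelow P m p q z
    lub p q fp≤ fq≤ with u , u≤ , p≤u , q≤u , least ← lubS fp≤ fq≤ =
      cl u , cl-least u≤ , f-reflect (p≤u ⨾ ≤-cl u) , f-reflect (q≤u ⨾ ≤-cl u) ,
      λ w w≤m p≤w q≤w → cl-least (least (f w) (f-mono w≤m) (f-mono p≤w) (f-mono q≤w))

    glb : ∀ p q → f p ≤ f m → f q ≤ f m → ∃[ z ] IsGLBBelow P m p q z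
    glb p q fp≤ fq≤ with l , l≤ , l≤p , l≤q , greatest ← glbS fp≤ fq≤ =
      cl l , cl-least l≤ , cl-least l≤p , cl-least l≤q ,
      λ w w≤m w≤p w≤q →
        f-reflect (greatest (f w) (f-mono w≤m) (f-mono w≤p) (f-mono w≤q) ⨾ ≤-cl l)

    -- The join `j` lies below the closure of the Boolean join `u`, and `f k` lies below the Boolean
    -- meet `l`, so the inequality for `u` and `l` is enough.
    semimodular : ∀ p q j k → p P.≤ m → q P.≤ m → IsLUBBelow P m p q j → IsGLBBelow P m p q k →
      r j + r k ≤ℕ r p + r q
    semimodular p q j k p≤m q≤m (_ , _ , _ , j-least) (k≤m , k≤p , k≤q , _) =
      let u , lubu@(u≤ , p≤u , q≤u , _) = lubS (f-mono p≤m) (f-mono q≤m)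
          l , glbl@(_ , _ , _ , greatest) = glbS (f-mono p≤m) (f-mono q≤m)
          j≤ = j-least (cl u) (cl-least u≤) (f-reflect (p≤u ⨾ ≤-cl u)) (f-reflect (q≤u ⨾ ≤-cl u))
          rj≤ρu = subst (r j ≤ℕ_) (r-cl u) (M2 (f j) (f (cl u)) (f-mono j≤))
          rk≤ρl = M2 (f k) l (greatest (f k) (f-mono k≤m) (f-mono k≤p) (f-mono k≤q))
      in ℕ.≤-trans (ℕ.+-mono-≤ rj≤ρu rk≤ρl) (ρ-lub (f-mono p≤m) lubu glbl)

    -- An atom of `S` below `f p` is either a loop, which is under every flat, or closes up to an
    -- atom of `P`, where `h` applies.
    atomistic : ∀ p q → p P.≤ m → q P.≤ m → (∀ a → r a ≡ 1 → a P.≤ p → a P.≤ q) → p P.≤ q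
    atomistic p q p≤m q≤m h = f-reflect (atoms-determine (f-mono p≤m) (f-mono q≤m) below)
      where
      below : ∀ s → IsAtom s → s ≤ f p → s ≤ f q
      below s at s≤fp with ρ s ≟ℕ 0
      ... | yes ρs≡0 = loop≤ q ρs≡0
      ... | no  ρs≢0 =
        ≤-cl s ⨾ f-mono (h (cl s) (trans (r-cl s) (ρ-nonloop at ρs≢0)) (cl-least s≤fp))

  exchange : ∀ x (A : Subset P.n) y → (∀ a → a ∈ A → r a ≡ 1) →
    InJoinSet P A y → r x < r y → r y ≡ ∣ A ∣ →
    ∃[ a ] (a ∈ A × ¬ (a P.≤ x) × JoinNonempty P a x)
  exchange x A y A-atoms (A≤y , y-min) rx<ry _ =
    let I , I≤fy , sound , complete = select below-A?
        fA≤I : ∀ a → a ∈ A → f a ≤ I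
        fA≤I a a∈A = atoms-determine (f-mono (A≤y a a∈A)) I≤fy
          λ s at s≤fa → complete s at (s≤fa ⨾ f-mono (A≤y a a∈A)) (a , a∈A , s≤fa)
        clI≡y = y-min (cl I) (λ a a∈A → f-reflect (fA≤I a a∈A ⨾ ≤-cl I)) (cl-least I≤fy)
        ρI≡ry = trans (sym (r-cl I)) (cong r clI≡y)
        s , at , s≤I , s≰fx , v , (fx≤v , s≤v) , _ = M5 (f x) I (subst (r x <_) (sym ρI≡ry) rx<ry)
        a , a∈A , s≤fa = sound s at s≤I
        -- A loop would lie below `f x`. So `s` and `f a` both have `ρ` one, and a flat above `s`
        -- must contain `f a`.
        ρs≡1 = ρ-nonloop at λ ρs≡0 → s≰fx (loop≤ x ρs≡0)
        fa≤ = flat-absorbs s≤fa (trans (A-atoms a a∈A) (sym ρs≡1)) (s≤v ⨾ ≤-cl v) (f-into (cl v))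
    in a , a∈A , (λ a≤x → s≰fx (s≤fa ⨾ f-mono a≤x)) ,
       bounded⇒join P (f-reflect fa≤) (f-reflect (fx≤v ⨾ ≤-cl v))
    where
    open Interval (f y)
    below-A? : ∀ s → Dec (∃[ a ] (a ∈ A × s ≤ f a))
    below-A? s = any? λ a → (a ∈? A) ×-dec (s ≤? f a)

  geometric : IsGeometricPoset P
  geometric = cl bot , r , cl-bot-min , r-ranked , (λ m _ → lattice m) , exchange

-- Joins of atoms in a geometric poset.

module Geometric (P : FinPoset) (G : IsGeometricPoset P) where
  open FinPoset P public
  open Order P public

  b : Fin n
  b = proj₁ G

  r : Fin n → ℕ
  r = proj₁ (proj₂ G)

  b-min : IsMinimum P b
  b-min = proj₁ (proj₂ (proj₂ G))

  ranked : IsRankFunction P b r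
  ranked = proj₁ (proj₂ (proj₂ (proj₂ G)))

  open Ranked P b-min ranked public

  lattice : ∀ m → IsMaximal P m → IsGeometricLatticeBelow P r m
  lattice = proj₁ (proj₂ (proj₂ (proj₂ (proj₂ G))))

  exchange : ∀ x (A : Subset n) y → (∀ a → a ∈ A → r a ≡ 1) →
    InJoinSet P A y → r x < r y → r y ≡ ∣ A ∣ → ∃[ a ] (a ∈ A × ¬ (a ≤ x) × JoinNonempty P a x)
  exchange = proj₂ (proj₂ (proj₂ (proj₂ (proj₂ G))))

  Atoms : Subset n → Set
  Atoms A = ∀ a → a ∈ A → r a ≡ 1

  -- Below a common bound, minimal upper bounds are least: the meet of z and w is again an
  -- upper bound of A.
  joinSet-least : ∀ {A z u w} → InJoinSet P A z → z ≤ u → w ≤ u → UpperBound P A w → z ≤ w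
  joinSet-least {A} {z} {u} {w} (A≤z , z-min) z≤u w≤u A≤w =
    let m , u≤m , max = maximum-above P u
        g , _ , g≤z , g≤w , greatest =
          proj₂ (proj₁ (lattice m max) z w (z≤u ⨾ u≤m) (w≤u ⨾ u≤m))
        g≡z = z-min g (λ a a∈A → greatest a (A≤z a a∈A ⨾ z≤u ⨾ u≤m) (A≤z a a∈A) (A≤w a a∈A)) g≤z
    in reflexive (sym g≡z) ⨾ g≤w

  joinSet-mono : ∀ {A B x y u} → A ⊆ B → InJoinSet P A x → InJoinSet P B y → x ≤ u → y ≤ u → x ≤ y
  joinSet-mono A⊆B jx jy x≤u y≤u = joinSet-least jx x≤u y≤u λ a a∈A → proj₁ jy a (A⊆B a∈A)

  -- In the lattice below a maximal element above `u`, minimality makes `u` the least upper bound of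
  -- `x` and `y`. Any common lower bound `l` lies under the greatest one.
  submodular : ∀ {x y u l} → InJoin P x y u → l ≤ x → l ≤ y → r u + r l ≤ℕ r x + r y
  submodular {x} {y} {u} {l} ((x≤u , y≤u) , u-min) l≤x l≤y =
    let m , u≤m , max = maximum-above P u
        x≤m = x≤u ⨾ u≤m
        y≤m = y≤u ⨾ u≤m
        (j , lub@(_ , x≤j , y≤j , least)) , (k , glb@(_ , _ , _ , greatest)) =
          proj₁ (lattice m max) x y x≤m y≤m
        j≡u = u-min j x≤j y≤j (least u u≤m x≤u y≤u)
        l≤k = greatest l (l≤x ⨾ x≤m) l≤x l≤y
    in ℕ.≤-trans (ℕ.+-mono-≤ (ℕ.≤-reflexive (cong r (sym j≡u))) (rank-mono l≤k))
         (proj₁ (proj₂ (lattice m max)) x y j k x≤m y≤m lub glb)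

  inJoinSet-⊥ : InJoinSet P ⊥ b
  inJoinSet-⊥ = (λ a a∈⊥ → contradiction a∈⊥ ∉⊥) , λ w _ w≤b → antisym w≤b (b-min w)

  ⁅a⁆-atoms : ∀ {a} → r a ≡ 1 → Atoms ⁅ a ⁆
  ⁅a⁆-atoms {a} ra≡1 c c∈ = subst (λ c → r c ≡ 1) (sym (x∈⁅y⁆⇒x≡y a c∈)) ra≡1

  ∪-atoms : ∀ A B → Atoms A → Atoms B → Atoms (A ∪ B)
  ∪-atoms A B hA hB c c∈ with x∈p∪q⁻ A B c∈
  ... | inj₁ c∈A = hA c c∈A
  ... | inj₂ c∈B = hB c c∈B

  ∪-upperBound : ∀ A B {z} → UpperBound P A z → UpperBound P B z → UpperBound P (A ∪ B) z
  ∪-upperBound A B hA hB c c∈ with x∈p∪q⁻ A B c∈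
  ... | inj₁ c∈A = hA c c∈A
  ... | inj₂ c∈B = hB c c∈B

  ⁅a⁆-upperBound : ∀ {a z} → a ≤ z → UpperBound P ⁅ a ⁆ z
  ⁅a⁆-upperBound {a} {z} a≤z c c∈ = subst (_≤ z) (sym (x∈⁅y⁆⇒x≡y a c∈)) a≤z

  -- An upper bound of the union below `z` shares the bound `z` with `x`, so `joinSet-least` places
  -- it above `x`.
  join-∪⁅a⁆ : ∀ {A x a z} → InJoinSet P A x → InJoin P x a z → InJoinSet P (A ∪ ⁅ a ⁆) z
  join-∪⁅a⁆ {A} {x} {a} {z} jx ((x≤z , a≤z) , z-min) =
    ∪-upperBound A ⁅ a ⁆ (λ c c∈A → proj₁ jx c c∈A ⨾ x≤z) (⁅a⁆-upperBound a≤z) ,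
    λ w ub w≤z → z-min w
      (joinSet-least jx x≤z w≤z λ c c∈A → ub c (p⊆p∪q ⁅ a ⁆ c∈A))
      (ub a (q⊆p∪q A ⁅ a ⁆ (x∈⁅x⁆ a))) w≤z

  -- Remove an atom `a`, take a basis for a join `z′ ≤ z` of the rest, and restore `a` exactly when
  -- it is not below `z′`. In that case submodularity with `r a ≡ 1` shows that the rank rises by
  -- exactly one.
  basis : ∀ A {z} → Atoms A → InJoinSet P A z → ∃[ B ] (B ⊆ A × InJoinSet P B z × r z ≡ ∣ B ∣)
  basis A = go A (<-wellFounded ∣ A ∣)
    where
    go : ∀ A {z} → Acc _<_ ∣ A ∣ → Atoms A → InJoinSet P A z →
      ∃[ B ] (B ⊆ A × InJoinSet P B z × r z ≡ ∣ B ∣)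
    go A {z} (acc rs) atoms jz with nonempty? A
    ... | no empty = ⊥ , ⊥⊆ , subst (InJoinSet P ⊥) b≡z inJoinSet-⊥ ,
        trans (cong r (sym b≡z)) (trans rank-bot (sym (∣⊥∣≡0 n)))
      where
      b≡z : b ≡ z
      b≡z = proj₂ jz b (λ a a∈A → contradiction (a , a∈A) empty) (b-min z)
    ... | yes (a , a∈A) with z′ , z′≤z , jz′ ← joinSet-below P {A - a}
                                (λ c c∈ → proj₁ jz c (p─q⊆p A ⁅ a ⁆ c∈))
                        with B , B⊆ , jB , rz′≡ ← go (A - a) (rs (x∈p⇒∣p-x∣<∣p∣ a∈A))
                                (λ c c∈ → atoms c (p─q⊆p A ⁅ a ⁆ c∈)) jz′
      = extend (a ≤? z′)
      where
      B⊆A : B ⊆ A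
      B⊆A c∈ = p─q⊆p A ⁅ a ⁆ (B⊆ c∈)

      bounds : ∀ {w} → UpperBound P (A - a) w → a ≤ w → UpperBound P A w
      bounds {w} ub a≤w c c∈A with c ≟ a
      ... | yes refl = a≤w
      ... | no  c≢a  = ub c (x∈p∧x≢y⇒x∈p-y c∈A c≢a)

      z-join : InJoin P z′ a z
      z-join = (z′≤z , proj₁ jz a a∈A) ,
        λ w z′≤w a≤w → proj₂ jz w (bounds (λ c c∈ → proj₁ jz′ c c∈ ⨾ z′≤w) a≤w)

      extend : Dec (a ≤ z′) → ∃[ B ] (B ⊆ A × InJoinSet P B z × r z ≡ ∣ B ∣)
      extend (yes a≤z′) = B , B⊆A , subst (InJoinSet P B) z′≡z jB , trans (cong r (sym z′≡z)) rz′≡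
        where
        z′≡z : z′ ≡ z
        z′≡z = proj₂ jz z′ (bounds (proj₁ jz′) a≤z′) z′≤z
      extend (no a≰z′) = B ∪ ⁅ a ⁆ , ∪-least B ⁅ a ⁆ B⊆A (⁅x⁆⊆p a∈A) , join-∪⁅a⁆ jB z-join ,
        trans rz≡ (trans (cong suc rz′≡) (sym (∣p∪⁅x⁆∣≡1+∣p∣ B λ a∈B → a≰z′ (proj₁ jB a a∈B))))
        where
        rz≤ : r z ≤ℕ suc (r z′)
        rz≤ = ℕ.≤-trans (ℕ.m≤m+n (r z) (r b))
          (subst (r z + r b ≤ℕ_) (trans (cong (r z′ +_) (atoms a a∈A)) (ℕ.+-comm (r z′) 1))
            (submodular z-join (b-min z′) (b-min a)))
        rz≡ : r z ≡ suc (r z′)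
        rz≡ = ℕ.≤-antisym rz≤ (rank-mono-< z′≤z λ z′≡z →
          a≰z′ (subst (a ≤_) (sym z′≡z) (proj₁ jz a a∈A)))

  atomsBelow? : ∀ x p → Dec (r p ≡ 1 × p ≤ x)
  atomsBelow? x p = (r p ≟ℕ 1) ×-dec (p ≤? x)

  atomsBelow : Fin n → Subset n
  atomsBelow x = sift (atomsBelow? x)

  atomsBelow-atoms : ∀ x → Atoms (atomsBelow x)
  atomsBelow-atoms x a a∈ = proj₁ (∈-sift⁻ (atomsBelow? x) a∈)

  ⊆-atomsBelow : ∀ {A x} → Atoms A → UpperBound P A x → A ⊆ atomsBelow x
  ⊆-atomsBelow {A} {x} atoms ub {a} a∈A = ∈-sift⁺ (atomsBelow? x) (atoms a a∈A , ub a a∈A)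

  -- This is atomisticity of the lattice below a maximal element over `x`.
  inJoinSet-atomsBelow : ∀ x → InJoinSet P (atomsBelow x) x
  inJoinSet-atomsBelow x = (λ a a∈ → proj₂ (∈-sift⁻ (atomsBelow? x) a∈)) , λ w ub w≤x →
    let m , x≤m , max = maximum-above P x
        x≤w = proj₂ (proj₂ (lattice m max)) x w x≤m (w≤x ⨾ x≤m)
          λ a ra≡1 a≤x → ub a (∈-sift⁺ (atomsBelow? x) (ra≡1 , a≤x))
    in antisym w≤x x≤w

-- The canonical matroid scheme of a geometric poset.

module Canonical (P : FinPoset) (G : IsGeometricPoset P) where
  open Geometric P G

  -- The second component is recorded because a set of atoms may have several minimal upper bounds.
  E : Set
  E = Subset n × Fin n

  Valid : E → Set
  Valid (A , x) = Atoms A × InJoinSet P A x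

  valid? : ∀ e → Dec (Valid e)
  valid? (A , x) = all? (λ a → (a ∈? A) →-dec (r a ≟ℕ 1)) ×-dec inJoinSet? P A x

  encodeE : E → Fin (2 ^ n * n)
  encodeE (A , x) = combine (encode A) x

  decodeE : Fin (2 ^ n * n) → E
  decodeE i = decode n (proj₁ (remQuot {2 ^ n} n i)) , proj₂ (remQuot {2 ^ n} n i)

  decode-encodeE : ∀ e → decodeE (encodeE e) ≡ e
  decode-encodeE (A , x) = cong₂ _,_
    (trans (cong (decode n ∘ proj₁) (remQuot-combine (encode A) x)) (decode-encode A))
    (cong proj₂ (remQuot-combine (encode A) x))

  opaque
    enumeration : Enumeration Valid
    enumeration = enumerate encodeE decodeE decode-encodeE valid?

  open Enumeration enumeration

  base : Fin size → Subset n
  base i = proj₁ (el i)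

  top : Fin size → Fin n
  top i = proj₂ (el i)

  base-atoms : ∀ i → Atoms (base i)
  base-atoms i = proj₁ (el-valid i)

  top-join : ∀ i → InJoinSet P (base i) (top i)
  top-join i = proj₂ (el-valid i)

  _≤E_ : E → E → Set
  (A , x) ≤E (B , y) = A ⊆ B × x ≤ y

  opaque
    ≤E? : ∀ e e′ → Dec (e ≤E e′)
    ≤E? (A , x) (B , y) = (A ⊆? B) ×-dec (x ≤? y)

  leC : Fin size → Fin size → Bool
  leC i j = isYes (≤E? (el i) (el j))

  infix 4 _≼_
  _≼_ : Fin size → Fin size → Set
  i ≼ j = T (leC i j)

  ≼⁺ : ∀ i j → base i ⊆ base j → top i ≤ top j → i ≼ j
  ≼⁺ i j p q = fromWitness {a? = ≤E? (el i) (el j)} (p , q)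

  ≼⇒⊆ : ∀ i j → i ≼ j → base i ⊆ base j
  ≼⇒⊆ i j t = proj₁ (toWitness {a? = ≤E? (el i) (el j)} t)

  ≼⇒≤ : ∀ i j → i ≼ j → top i ≤ top j
  ≼⇒≤ i j t = proj₂ (toWitness {a? = ≤E? (el i) (el j)} t)

  ≼-trans : ∀ i j k → i ≼ j → j ≼ k → i ≼ k
  ≼-trans i j k p q = ≼⁺ i k (λ x∈ → ≼⇒⊆ j k q (≼⇒⊆ i j p x∈)) (≼⇒≤ i j p ⨾ ≼⇒≤ j k q)

  el-≡ : ∀ i j → base i ≡ base j → top i ≡ top j → i ≡ j
  el-≡ i j p q = el-injective (cong₂ _,_ p q)

  ≼-antisym : ∀ i j → i ≼ j → j ≼ i → i ≡ j
  ≼-antisym i j p q = el-≡ i j (⊆-antisym (≼⇒⊆ i j p) (≼⇒⊆ j i q)) (antisym (≼⇒≤ i j p) (≼⇒≤ j i q))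

  C : FinPoset
  C = record
    { n = size ; le = leC
    ; ≤-refl = λ i → ≼⁺ i i (λ x∈ → x∈) (≤-refl (top i))
    ; ≤-antisym = ≼-antisym
    ; ≤-trans = ≼-trans }

  opaque
    node : ∀ {A x} → Atoms A → InJoinSet P A x → ∃[ i ] (base i ≡ A × top i ≡ x)
    node {A} {x} atoms jx with i , eq ← el-onto (A , x) (atoms , jx) = i , cong proj₁ eq , cong proj₂ eq

  -- Below the common bound `top k`, each top is the least upper bound of its base, so bases alone
  -- decide the order.
  ⊆⇒≼ : ∀ i j k → i ≼ k → j ≼ k → base i ⊆ base j → i ≼ j
  ⊆⇒≼ i j k i≼k j≼k sub =
    ≼⁺ i j sub (joinSet-mono sub (top-join i) (top-join j) (≼⇒≤ i k i≼k) (≼⇒≤ j k j≼k))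

  opaque
    -- A minimal upper bound of `A` chosen below `top j` serves as the top. By `⊆⇒≼` the node is
    -- unique, so the interval below `j` is a power set.
    restrict : ∀ j {A} → A ⊆ base j → ∃[ k ] (k ≼ j × base k ≡ A)
    restrict j {A} A⊆
      with z , z≤ , jz ← joinSet-below P {A} (λ a a∈A → proj₁ (top-join j) a (A⊆ a∈A))
      with k , base≡ , top≡ ← node (λ a a∈A → base-atoms j a (A⊆ a∈A)) jz
      = k , ≼⁺ k j (λ x∈ → A⊆ (subst (_ ∈_) base≡ x∈)) (subst (_≤ top j) (sym top≡) z≤) , base≡

  bot : Fin size
  bot = proj₁ (node (λ a a∈⊥ → contradiction a∈⊥ ∉⊥) inJoinSet-⊥)

  base-bot : base bot ≡ ⊥
  base-bot = proj₁ (proj₂ (node (λ a a∈⊥ → contradiction a∈⊥ ∉⊥) inJoinSet-⊥))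

  top-bot : top bot ≡ b
  top-bot = proj₂ (proj₂ (node (λ a a∈⊥ → contradiction a∈⊥ ∉⊥) inJoinSet-⊥))

  bot-min : IsMinimum C bot
  bot-min i = ≼⁺ bot i (subst (_⊆ base i) (sym base-bot) ⊥⊆) (subst (_≤ top i) (sym top-bot) (b-min (top i)))

  rk : Fin size → ℕ
  rk i = ∣ base i ∣

  -- By `⊆⇒≼`, some `p` in `base j` is missing from `base i`. The node below `j` over
  -- `base i ∪ ⁅ p ⁆` lies between the two and differs from `i`, so it is `j`.
  rk-cover : ∀ i j → Covers C i j → rk j ≡ suc (rk i)
  rk-cover i j (i≼j , i≢j , between)
    with any? (λ p → (p ∈? base j) ×-dec ¬? (p ∈? base i))
  ... | no none = contradiction (≼-antisym i j i≼j
          (⊆⇒≼ j i j (FinPoset.≤-refl C j) i≼j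
            λ {p} p∈j → decidable-stable (p ∈? base i) λ p∉i → none (p , p∈j , p∉i))) i≢j
  ... | yes (p , p∈j , p∉i)
    with k , k≼j , base≡ ← restrict j (∪-least (base i) ⁅ p ⁆ (≼⇒⊆ i j i≼j) (⁅x⁆⊆p p∈j))
    with between k (⊆⇒≼ i k j i≼j k≼j (λ x∈ → subst (_ ∈_) (sym base≡) (p⊆p∪q ⁅ p ⁆ x∈))) k≼j
  ...   | inj₁ refl = contradiction (subst (p ∈_) (sym base≡) (q⊆p∪q (base k) ⁅ p ⁆ (x∈⁅x⁆ p))) p∉i
  ...   | inj₂ refl = trans (cong ∣_∣ base≡) (∣p∪⁅x⁆∣≡1+∣p∣ (base i) p∉i)

  rk-ranked : IsRankFunction C bot rk
  rk-ranked = trans (cong ∣_∣ base-bot) (∣⊥∣≡0 n) ,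
    (λ i j i≼j → p⊆q⇒∣p∣≤∣q∣ (≼⇒⊆ i j i≼j)) , rk-cover

  -- Index sets correspond to subsets of `base j` through `index`, and these to nodes below `j`
  -- through `restrict`.
  boolean : ∀ j → Σ ℕ λ k → IsoOnto (Subset k) _⊆_ C (λ i → i ≼ j)
  boolean j = rk j , record
    { f = λ I → proj₁ (sub I)
    ; f-into = λ I → proj₁ (proj₂ (sub I))
    ; f-onto = onto
    ; f-injective = λ I J eq → ⊆-antisym (reflect I J (reflexiveC eq)) (reflect J I (reflexiveC (sym eq)))
    ; f-order = λ I J → mk⇔ (mono I J) (reflect I J) }
    where
    B = base j

    reflexiveC : ∀ {i k} → i ≡ k → i ≼ k
    reflexiveC {i} refl = FinPoset.≤-refl C i

    image? : ∀ I p → Dec (∃[ i ] (i ∈ I × index B i ≡ p))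
    image? I p = any? λ i → (i ∈? I) ×-dec (index B i ≟ p)

    image : Subset (rk j) → Subset n
    image I = sift (image? I)

    image-⊆ : ∀ I → image I ⊆ B
    image-⊆ I p∈ with i , _ , refl ← ∈-sift⁻ (image? I) p∈ = index-∈ B i

    sub : ∀ I → ∃[ k ] (k ≼ j × base k ≡ image I)
    sub I = restrict j (image-⊆ I)

    mono : ∀ I J → I ⊆ J → proj₁ (sub I) ≼ proj₁ (sub J)
    mono I J I⊆J with k , k≼j , eq ← sub I | l , l≼j , eq′ ← sub J =
      ⊆⇒≼ k l j k≼j l≼j (subst₂ _⊆_ (sym eq) (sym eq′) image-mono)
      where
      image-mono : image I ⊆ image J
      image-mono p∈ with i , i∈I , eq ← ∈-sift⁻ (image? I) p∈ =
        ∈-sift⁺ (image? J) (i , I⊆J i∈I , eq)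

    reflect : ∀ I J → proj₁ (sub I) ≼ proj₁ (sub J) → I ⊆ J
    reflect I J I≼J {i} i∈I with k , k≼j , eq ← sub I | l , l≼j , eq′ ← sub J
      with i′ , i′∈J , same ← ∈-sift⁻ (image? J) (subst (_ ∈_) eq′ (≼⇒⊆ k l I≼J
             (subst (_ ∈_) (sym eq) (∈-sift⁺ (image? I) (i , i∈I , refl)))))
      = subst (_∈ J) (index-injective B same) i′∈J

    onto : ∀ k → k ≼ j → ∃[ I ] proj₁ (sub I) ≡ k
    onto k k≼j = I , ≼-antisym l k
        (⊆⇒≼ l k j l≼j k≼j (subst (_⊆ base k) (sym eq) to))
        (⊆⇒≼ k l j k≼j l≼j (subst (base k ⊆_) (sym eq) from))
      where
      preimage? : ∀ i → Dec (index B i ∈ base k)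
      preimage? i = index B i ∈? base k
      I = sift preimage?
      l = proj₁ (sub I)
      l≼j = proj₁ (proj₂ (sub I))
      eq : base l ≡ image I
      eq = proj₂ (proj₂ (sub I))
      to : image I ⊆ base k
      to p∈ with i , i∈I , refl ← ∈-sift⁻ (image? I) p∈ = ∈-sift⁻ preimage? i∈I
      from : base k ⊆ image I
      from p∈ with i , refl ← index-onto B (≼⇒⊆ k j k≼j p∈) =
        ∈-sift⁺ (image? I) (i , ∈-sift⁺ preimage? p∈ , refl)

  simplicial : SimplicialPoset
  simplicial = record
    { poset = C ; bot = bot ; bot-min = bot-min ; rk = rk ; rk-ranked = rk-ranked ; boolean = boolean }

  ρ : Fin size → ℕ
  ρ i = r (top i)

  -- A basis inside `base i` has exactly `ρ i` members.
  ρ≤rk : ∀ i → ρ i ≤ℕ rk i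
  ρ≤rk i with B , B⊆ , _ , r≡ ← basis (base i) (base-atoms i) (top-join i) =
    subst (_≤ℕ rk i) (sym r≡) (p⊆q⇒∣p∣≤∣q∣ B⊆)

  -- A bound `w` below `top k` dominates a minimal bound `z` of `base i ∪ base j`. The node over
  -- this union with top `z` is above `i` and `j` and below `k`, hence equals `k`, so `top k ≤ w`.
  top-InJoin : ∀ i j k → InJoin C i j k → InJoin P (top i) (top j) (top k)
  top-InJoin i j k ((i≼k , j≼k) , k-min) = (≼⇒≤ i k i≼k , ≼⇒≤ j k j≼k) , minimal
    where
    minimal : ∀ w → top i ≤ w → top j ≤ w → w ≤ top k → w ≡ top k
    minimal w i≤w j≤w w≤k
      with z , z≤w , jz ← joinSet-below P {base i ∪ base j} (∪-upperBound (base i) (base j)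
             (λ a a∈ → proj₁ (top-join i) a a∈ ⨾ i≤w) (λ a a∈ → proj₁ (top-join j) a a∈ ⨾ j≤w))
      with l , base≡ , refl ← node (∪-atoms (base i) (base j) (base-atoms i) (base-atoms j)) jz
      = antisym w≤k (subst (_≤ w) (cong top l≡k) z≤w)
      where
      above : ∀ h → base h ⊆ base i ∪ base j → h ≼ k → h ≼ l
      above h sub h≼k = ≼⁺ h l (subst (base h ⊆_) (sym base≡) sub)
        (joinSet-mono sub (top-join h) jz (≼⇒≤ h k h≼k) (z≤w ⨾ w≤k))
      l≡k : l ≡ k
      l≡k = k-min l (above i (p⊆p∪q (base j)) i≼k) (above j (q⊆p∪q (base i) (base j)) j≼k)
        (≼⁺ l k (subst (_⊆ base k) (sym base≡) (∪-least (base i) (base j) (≼⇒⊆ i k i≼k) (≼⇒⊆ j k j≼k)))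
          (z≤w ⨾ w≤k))

  M3 : ∀ i j k l → InJoin C i j k → InMeet C i j l → ρ k + ρ l ≤ℕ ρ i + ρ j
  M3 i j k l join ((l≼i , l≼j) , _) =
    submodular (top-InJoin i j k join) (≼⇒≤ l i l≼i) (≼⇒≤ l j l≼j)

  -- Equal ranks give `top i ≡ top l`, hence `top i ≤ top j`. Then `top j` is also a minimal upper
  -- bound of `base i ∪ base j`, and the resulting node bounds both.
  M4 : ∀ i j l → InMeet C i j l → ρ i ≡ ρ l → JoinNonempty C i j
  M4 i j l ((l≼i , l≼j) , _) ρi≡ρl
    with i≤j ← reflexive (sym (rank-strict (≼⇒≤ l i l≼i) (sym ρi≡ρl))) ⨾ ≼⇒≤ l j l≼j
    with k , base≡ , top≡ ← node (∪-atoms (base i) (base j) (base-atoms i) (base-atoms j))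
           (∪-upperBound (base i) (base j) (λ a a∈ → proj₁ (top-join i) a a∈ ⨾ i≤j) (proj₁ (top-join j)) ,
            λ w ub → proj₂ (top-join j) w λ a a∈ → ub a (q⊆p∪q (base i) (base j) a∈))
    = bounded⇒join C
        (≼⁺ i k (subst (base i ⊆_) (sym base≡) (p⊆p∪q (base j))) (subst (top i ≤_) (sym top≡) i≤j))
        (≼⁺ j k (subst (base j ⊆_) (sym base≡) (q⊆p∪q (base i) (base j))) (reflexive (sym top≡)))
  inJoinSet-⁅a⁆ : ∀ {a} → InJoinSet P ⁅ a ⁆ a
  inJoinSet-⁅a⁆ {a} = ⁅a⁆-upperBound (≤-refl a) , λ w ub w≤a → antisym w≤a (ub a (x∈⁅x⁆ a))

  -- A basis of `base j` meets the cardinality condition of (G2), which supplies an atom `a` not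
  -- below `top i` and a join `z` of the two. The node over `⁅ a ⁆` is the atom sought, and the node
  -- over `base i ∪ ⁅ a ⁆` with top `z` is the bound.
  M5 : ∀ i j → ρ i < ρ j → ∃[ s ] (rk s ≡ 1 × s ≼ j × ¬ (s ≼ i) × JoinNonempty C i s)
  M5 i j ρi<ρj
    with B , B⊆ , jB , r≡ ← basis (base j) (base-atoms j) (top-join j)
    with a , a∈B , a≰ , z , (a≤z , i≤z) , z-min ←
      exchange (top i) B (top j) (λ a a∈B → base-atoms j a (B⊆ a∈B)) jB ρi<ρj r≡
    with ra≡1 ← base-atoms j a (B⊆ a∈B)
    with s , s-base , s-top ← node (⁅a⁆-atoms ra≡1) inJoinSet-⁅a⁆
    with k , k-base , k-top ← node (∪-atoms (base i) ⁅ a ⁆ (base-atoms i) (⁅a⁆-atoms ra≡1))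
           (join-∪⁅a⁆ (top-join i) ((i≤z , a≤z) , λ w i≤w a≤w → z-min w a≤w i≤w))
    = s , trans (cong ∣_∣ s-base) (∣⁅x⁆∣≡1 a)
    , ≼⁺ s j (subst (_⊆ base j) (sym s-base) (⁅x⁆⊆p (B⊆ a∈B)))
             (subst (_≤ top j) (sym s-top) (proj₁ jB a a∈B))
    , (λ s≼i → a≰ (subst (_≤ top i) s-top (≼⇒≤ s i s≼i)))
    , bounded⇒join C
        (≼⁺ i k (subst (base i ⊆_) (sym k-base) (p⊆p∪q ⁅ a ⁆)) (subst (top i ≤_) (sym k-top) i≤z))
        (≼⁺ s k (subst₂ _⊆_ (sym s-base) (sym k-base) (q⊆p∪q (base i) ⁅ a ⁆))
                (subst₂ _≤_ (sym s-top) (sym k-top) a≤z))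

  scheme : MatroidScheme
  scheme = record
    { S = simplicial ; ρ = ρ ; M1 = ρ≤rk ; M2 = λ i j i≼j → rank-mono (≼⇒≤ i j i≼j)
    ; M3 = M3 ; M4 = M4 ; M5 = M5 }

  open MatroidScheme scheme using (IsFlat; IsSimple)

  -- An element above `i` with equal `ρ` has the same top, so its base consists of atoms already in
  -- `base i`.
  atomsBelow⊆base⇒flat : ∀ i → atomsBelow (top i) ⊆ base i → IsFlat i
  atomsBelow⊆base⇒flat i sub j i≼j ρj≡ρi =
    ≼⁺ j i (λ {a} a∈ → sub (⊆-atomsBelow (base-atoms j)
             (λ c c∈ → proj₁ (top-join j) c c∈ ⨾ reflexive (sym top≡)) a∈))
           (reflexive (sym top≡))
    where
    top≡ : top i ≡ top j
    top≡ = rank-strict (≼⇒≤ i j i≼j) (sym ρj≡ρi)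

  full : ∀ x → ∃[ i ] (base i ≡ atomsBelow x × top i ≡ x)
  full x = node (atomsBelow-atoms x) (inJoinSet-atomsBelow x)

  flats : P ≅Flats scheme
  flats = record
    { f = φ
    ; f-into = λ x → atomsBelow⊆base⇒flat (φ x)
        (subst (atomsBelow (top (φ x)) ⊆_) (sym (φ-base x))
          (subst (λ y → atomsBelow y ⊆ atomsBelow x) (sym (φ-top x)) (λ a∈ → a∈)))
    -- Every `i` lies below `φ (top i)` with equal `ρ`; flatness gives the reverse comparison.
    ; f-onto = λ i flat → top i , ≼-antisym (φ (top i)) i
        (flat (φ (top i)) (below i) (cong r (φ-top (top i)))) (below i)
    ; f-injective = λ x y eq → trans (sym (φ-top x)) (trans (cong top eq) (φ-top y))
    ; f-order = λ x y → mk⇔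
        (λ x≤y → ≼⁺ (φ x) (φ y)
          (subst₂ _⊆_ (sym (φ-base x)) (sym (φ-base y))
            (⊆-atomsBelow (atomsBelow-atoms x) λ a a∈ → proj₁ (inJoinSet-atomsBelow x) a a∈ ⨾ x≤y))
          (subst₂ _≤_ (sym (φ-top x)) (sym (φ-top y)) x≤y))
        (λ φx≼φy → subst₂ _≤_ (φ-top x) (φ-top y) (≼⇒≤ (φ x) (φ y) φx≼φy)) }
    where
    φ : Fin n → Fin size
    φ x = proj₁ (full x)
    φ-base : ∀ x → base (φ x) ≡ atomsBelow x
    φ-base x = proj₁ (proj₂ (full x))
    φ-top : ∀ x → top (φ x) ≡ x
    φ-top x = proj₂ (proj₂ (full x))
    below : ∀ i → i ≼ φ (top i)
    below i = ≼⁺ i (φ (top i))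
      (subst (base i ⊆_) (sym (φ-base (top i))) (⊆-atomsBelow (base-atoms i) (proj₁ (top-join i))))
      (reflexive (sym (φ-top (top i))))

  -- The base contains some atom `a`, and `top i` has rank at most one by `ρ≤rk`. So `top i` is `a`,
  -- and every atom below it is `a` as well.
  simple : IsSimple
  simple i rk≡1 with nonempty? (base i)
  ... | no empty with () ← trans (sym rk≡1) (trans (cong ∣_∣ (Empty-unique empty)) (∣⊥∣≡0 n))
  ... | yes (a , a∈) = atomsBelow⊆base⇒flat i only-a , λ ρ≡0 → ℕ.0≢1+n (trans (sym ρ≡0) ρ≡1)
    where
    ra≡1 : r a ≡ 1
    ra≡1 = base-atoms i a a∈
    a≤ : a ≤ top i
    a≤ = proj₁ (top-join i) a a∈
    ρ≡1 : ρ i ≡ 1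
    ρ≡1 = ℕ.≤-antisym (subst (ρ i ≤ℕ_) rk≡1 (ρ≤rk i)) (subst (_≤ℕ ρ i) ra≡1 (rank-mono a≤))
    only-a : atomsBelow (top i) ⊆ base i
    only-a {c} c∈ with rc≡1 , c≤ ← ∈-sift⁻ (atomsBelow? (top i)) c∈ =
      subst (_∈ base i)
        (trans (rank-strict a≤ (trans ra≡1 (sym ρ≡1))) (sym (rank-strict c≤ (trans rc≡1 (sym ρ≡1))))) a∈

-- Every simple scheme is isomorphic to the canonical one.

module SimpleScheme (M : MatroidScheme) (simpleM : MatroidScheme.IsSimple M)
  (P : FinPoset) (G : IsGeometricPoset P) (iso : P ≅Flats M) where
  open MatroidScheme M
  open Flats M
  open FlatPoset M P iso using (module P; f-mono; f-reflect; cl; ≤-cl; r-cl; cl-least; cl-bot-min; r-ranked)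
  open IsoOnto iso
  open Geometric P G using (Atoms) renaming (r to rP)
  private
    module G = Geometric P G
    module C = Canonical P G

  rP≡ρf : ∀ p → rP p ≡ ρ (f p)
  rP≡ρf = rank-unique P G.b-min cl-bot-min G.ranked r-ranked

  atom⇒flat : ∀ {s} → IsAtom s → ∃[ p ] (f p ≡ s × rP p ≡ 1)
  atom⇒flat {s} at with p , refl ← f-onto s (proj₁ (simpleM s at)) =
    p , refl , trans (rP≡ρf p) (ρ-nonloop at (proj₂ (simpleM s at)))

  -- (M5) against `bot` yields an atom `s` below `f p`. Both have `ρ` one and `s` is a flat by
  -- simplicity, so they coincide. With `atom⇒flat`, this matches the atoms of `S` with those of
  -- `P`.
  rP≡1⇒atom : ∀ p → rP p ≡ 1 → IsAtom (f p)
  rP≡1⇒atom p rp≡1 =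
    let ρ≡1 = trans (sym (rP≡ρf p)) rp≡1
        s , at , s≤fp , _ = M5 bot (f p) (subst₂ _<_ (sym ρ-bot) (sym ρ≡1) (s≤s z≤n))
        flat , nonloop = simpleM s at
        fp≤s = flat (f p) s≤fp (trans ρ≡1 (sym (ρ-nonloop at nonloop)))
    in subst IsAtom (antisym s≤fp fp≤s) at

  support? : ∀ s p → Dec (rP p ≡ 1 × f p ≤ s)
  support? s p = (rP p ≟ℕ 1) ×-dec (f p ≤? s)

  support : Fin n → Subset P.n
  support s = sift (support? s)

  support-reflect : ∀ {s t u} → s ≤ u → t ≤ u →
    (∀ p → rP p ≡ 1 → f p ≤ s → f p ≤ t) → s ≤ t
  support-reflect {s} {t} {u} s≤u t≤u sub = Interval.atoms-determine u s≤u t≤u below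
    where
    below : ∀ a → IsAtom a → a ≤ s → a ≤ t
    below a at a≤s with p , refl , rp≡1 ← atom⇒flat at = sub p rp≡1 a≤s

  support-atoms : ∀ s → Atoms (support s)
  support-atoms s p p∈ = proj₁ (∈-sift⁻ (support? s) p∈)

  -- If `w` below `cl s` bounds the support, all atoms of `s` lie below `f w`. Hence `s ≤ f w`, and
  -- the adjunction gives `cl s ≤ w`.
  support-join : ∀ s → InJoinSet P (support s) (cl s)
  support-join s =
    (λ p p∈ → f-reflect (proj₂ (∈-sift⁻ (support? s) p∈) ⨾ ≤-cl s)) ,
    λ w ub w≤cl → P.antisym w≤cl (cl-least (support-reflect (≤-cl s) (f-mono w≤cl)
      λ p rp≡1 fp≤s → f-mono (ub p (∈-sift⁺ (support? s) (rp≡1 , fp≤s)))))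

  φ : Fin n → Fin (FinPoset.n C.C)
  φ s = proj₁ (C.node (support-atoms s) (support-join s))

  φ-base : ∀ s → C.base (φ s) ≡ support s
  φ-base s = proj₁ (proj₂ (C.node (support-atoms s) (support-join s)))

  φ-top : ∀ s → C.top (φ s) ≡ cl s
  φ-top s = proj₂ (proj₂ (C.node (support-atoms s) (support-join s)))

  φ-mono : ∀ {s t} → s ≤ t → φ s C.≼ φ t
  φ-mono {s} {t} s≤t = C.≼⁺ (φ s) (φ t)
    (subst₂ _⊆_ (sym (φ-base s)) (sym (φ-base t)) λ p∈ →
      let rp≡1 , fp≤s = ∈-sift⁻ (support? s) p∈ in ∈-sift⁺ (support? t) (rp≡1 , fp≤s ⨾ s≤t))
    (subst₂ P._≤_ (sym (φ-top s)) (sym (φ-top t)) (cl-least (s≤t ⨾ ≤-cl t)))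

  -- The comparison of closures puts `s` and `t` under the common bound `f (cl t)`, and there the
  -- supports decide.
  φ-reflect : ∀ {s t} → φ s C.≼ φ t → s ≤ t
  φ-reflect {s} {t} φs≼φt = support-reflect (≤-cl s ⨾ f-mono cls≤clt) (≤-cl t)
    λ p rp≡1 fp≤s → proj₂ (∈-sift⁻ (support? t) (sub (∈-sift⁺ (support? s) (rp≡1 , fp≤s))))
    where
    sub : support s ⊆ support t
    sub = subst₂ _⊆_ (φ-base s) (φ-base t) (C.≼⇒⊆ (φ s) (φ t) φs≼φt)
    cls≤clt : cl s P.≤ cl t
    cls≤clt = subst₂ P._≤_ (φ-top s) (φ-top t) (C.≼⇒≤ (φ s) (φ t) φs≼φt)

  -- The preimage is the element below `f (C.top i)` whose atoms are the images of `A`. Minimality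
  -- of `C.top i` over `A` identifies its closure.
  φ-onto : ∀ i → ∃[ s ] φ s ≡ i
  φ-onto i =
    let s , s≤fx , sound , complete = select in-A?
        support⊆A : support s ⊆ A
        support⊆A {p} p∈ =
          let rp≡1 , fp≤s = ∈-sift⁻ (support? s) p∈
              q , q∈A , fq≡fp = sound (f p) (rP≡1⇒atom p rp≡1) fp≤s
          in subst (_∈ A) (f-injective q p fq≡fp) q∈A
        A≤s : ∀ p → p ∈ A → f p ≤ s
        A≤s p p∈A = complete (f p) (rP≡1⇒atom p (C.base-atoms i p p∈A))
          (f-mono (proj₁ (C.top-join i) p p∈A)) (p , p∈A , refl)
        A⊆support : A ⊆ support s
        A⊆support {p} p∈A = ∈-sift⁺ (support? s) (C.base-atoms i p p∈A , A≤s p p∈A)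
        cl≡x = proj₂ (C.top-join i) (cl s) (λ p p∈A → f-reflect (A≤s p p∈A ⨾ ≤-cl s)) (cl-least s≤fx)
    in s , C.el-≡ (φ s) i (trans (φ-base s) (⊆-antisym support⊆A A⊆support)) (trans (φ-top s) cl≡x)
    where
    A : Subset P.n
    A = C.base i
    open Interval (f (C.top i))
    in-A? : ∀ a → Dec (∃[ p ] (p ∈ A × f p ≡ a))
    in-A? a = any? λ p → (p ∈? A) ×-dec (f p ≟ a)

  ≅canonical : M ≅MS C.scheme
  ≅canonical = record
    { f = φ
    ; f-into = λ _ → tt
    ; f-onto = λ i _ → φ-onto i
    ; f-injective = λ s t eq → antisym (φ-reflect (reflexiveC eq)) (φ-reflect (reflexiveC (sym eq)))
    ; f-order = λ s t → mk⇔ φ-mono φ-reflect }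
    , λ s → trans (cong rP (φ-top s)) (trans (rP≡ρf (cl s)) (r-cl s))
    where
    reflexiveC : ∀ {i j} → i ≡ j → i C.≼ j
    reflexiveC {i} refl = FinPoset.≤-refl C.C i

-- Comparing two simple schemes, and conclusion.

≅MS-cospan : ∀ {M M′ K} → M ≅MS K → M′ ≅MS K → M ≅MS M′
≅MS-cospan {M} {M′} {K} (φ , φ-ρ) (ψ , ψ-ρ) = record
  { f = g
  ; f-into = λ _ → tt
  ; f-onto = λ y _ → let x , eq = Φ.f-onto (Ψ.f y) tt in
      x , Ψ.f-injective (g x) y (trans (Ψ.f-onto (Φ.f x) tt .proj₂) eq)
  ; f-injective = λ x y eq →
      Φ.f-injective x y (trans (sym (ψg≡φ x)) (trans (cong Ψ.f eq) (ψg≡φ y)))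
  ; f-order = λ x y → mk⇔
      (λ x≤y → Equivalence.from (Ψ.f-order (g x) (g y))
        (subst₂ K._≤_ (sym (ψg≡φ x)) (sym (ψg≡φ y)) (Equivalence.to (Φ.f-order x y) x≤y)))
      (λ gx≤gy → Equivalence.from (Φ.f-order x y)
        (subst₂ K._≤_ (ψg≡φ x) (ψg≡φ y) (Equivalence.to (Ψ.f-order (g x) (g y)) gx≤gy))) }
  , λ x → trans (sym (ψ-ρ (g x))) (trans (cong K.ρ (ψg≡φ x)) (φ-ρ x))
  where
  module Φ = IsoOnto φ
  module Ψ = IsoOnto ψ
  module K = MatroidScheme K
  -- This is `φ` followed by the inverse of `ψ`, read off from surjectivity.
  g : Fin (MatroidScheme.n M) → Fin (MatroidScheme.n M′)
  g x = proj₁ (Ψ.f-onto (Φ.f x) tt)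
  ψg≡φ : ∀ x → Ψ.f (g x) ≡ Φ.f x
  ψg≡φ x = proj₂ (Ψ.f-onto (Φ.f x) tt)

theorem9p6 : (∀ (P : FinPoset) → IsGeometricPoset P ⇔ (∃[ M ] P ≅Flats M))
    × (∀ (P : FinPoset) → IsGeometricPoset P →
    (∃[ M ] (MatroidScheme.IsSimple M × P ≅Flats M))
    × (∀ M M' → MatroidScheme.IsSimple M → MatroidScheme.IsSimple M' →
    P ≅Flats M → P ≅Flats M' → M ≅MS M'))
theorem9p6 =
  (λ P → mk⇔ (λ G → Canonical.scheme P G , Canonical.flats P G)
             (λ (M , iso) → FlatPoset.geometric M P iso)) ,
  λ P G → (Canonical.scheme P G , Canonical.simple P G , Canonical.flats P G) ,
    λ M M' simple simple' iso iso' →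
      ≅MS-cospan {M} {M'} {Canonical.scheme P G}
        (SimpleScheme.≅canonical M simple P G iso) (SimpleScheme.≅canonical M' simple' P G iso')
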